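{- For every integer $m\geq 2$ and every integer $n\geq 3$, the graph $mTL_n$ (the disjoint union of $m$ copies of the triangular ladder $TL_n$) is $C_3$-supermagic.
   Context: All graphs are finite and simple. For a graph $H$, a graph $G=(V,E)$ has an $H$-covering if every edge of $G$ belongs to a subgraph of $G$ isomorphic to $H$. For such $G$, an $H$-magic labeling is a bijection $\lambda: V\cup E\to\{1,2,\dots,|V|+|E|\}$ for which there is a constant $c$ such that for every subgraph $H'=(V',E')$ of $G$ isomorphic to $H$, $\sum_{v\in V'}\lambda(v)+\sum_{e\in E'}\lambda(e)=c$. It is $H$-supermagic if moreover $\{\lambda(v):v\in V\}=\{1,\dots,|V|\}$; $G$ is $H$-supermagic if it admits such a labeling. $C_k$ is the cycle of length $k$. $mG$ denotes the disjoint union of $m$ copies of $G$. The triangular ladder $TL_n$ has vertices $u_i,v_i$ ($1\le i\le n$) and edges $u_iv_i$ ($1\le i\le n$), and $u_iu_{i+1}$, $v_iv_{i+1}$, $u_{i+1}v_i$ ($1\le i\le n-1$). -}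

module Defs where

open import Algebra.Properties.CommutativeMonoid.Sum using (sum)
open import Data.Bool.Base using (Bool; true; false; T)
open import Data.Bool.Properties using (T-irrelevant)
open import Data.Empty using (⊥-elim)
open import Data.Fin.Base using (Fin; zero; suc; toℕ; fromℕ; inject₁)
open import Data.Fin.Properties
  using (toℕ-inject₁; inject₁-injective; fromℕ≢inject₁; suc-injective; +↔⊎; *↔×; 0↔⊥; 1↔⊤)
open import Data.Nat.Base using (ℕ; zero; suc; pred; _+_; _*_; _≤_; _<_; s≤s)
open import Data.Nat.Properties
  using (+-0-commutativeMonoid; <-irrefl; <-asym; ≤-refl; n<1+n; +-suc; +-mono-≤; +-mono-<)
open import Data.Product.Base using (Σ; ∃-syntax; _×_; _,_; proj₁; proj₂; swap)
open import Data.Product.Function.NonDependent.Propositional using (_×-↔_)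
open import Data.Sum.Base using (_⊎_; inj₁; inj₂)
open import Data.Sum.Function.Propositional using (_⊎-↔_)
open import Function.Base using (_∘_)
open import Function.Bundles using (_↔_; _⤖_; _⇔_; mk↔ₛ′; Inverse; Bijection)
open import Function.Properties.Inverse using (↔-refl; ↔-sym; ↔-trans)
open import Relation.Binary.PropositionalEquality
  using (_≡_; _≢_; refl; sym; cong; cong₂; subst)

------------------------------------------------------------------------
-- Finite types

record Finite (A : Set) : Set where
  field
    card : ℕ
    enum : A ↔ Fin card

open Finite public

-- Independent of the chosen enumeration, by commutativity.
∑ : {A : Set} → Finite A → (A → ℕ) → ℕ
∑ fin f = sum +-0-commutativeMonoid (f ∘ Inverse.from (enum fin))

via : {A B : Set} → A ↔ B → Finite B → Finite A
via i fin = record { card = card fin ; enum = ↔-trans i (enum fin) }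

Fin-finite : ∀ n → Finite (Fin n)
Fin-finite n = record { card = n ; enum = ↔-refl }

infixr 2 _×-finite_
infixr 1 _⊎-finite_

_⊎-finite_ : {A B : Set} → Finite A → Finite B → Finite (A ⊎ B)
a ⊎-finite b = record
  { card = card a + card b
  ; enum = ↔-trans (enum a ⊎-↔ enum b) (↔-sym +↔⊎)
  }

_×-finite_ : {A B : Set} → Finite A → Finite B → Finite (A × B)
a ×-finite b = record
  { card = card a * card b
  ; enum = ↔-trans (enum a ×-↔ enum b) (↔-sym *↔×)
  }

-- The elements of A selected by a Boolean characteristic function.
⟪_⟫ : {A : Set} → (A → Bool) → Set
⟪ p ⟫ = Σ _ (T ∘ p)

⟪⟫-≡ : {A : Set} {p : A → Bool} {x y : ⟪ p ⟫} → proj₁ x ≡ proj₁ y → x ≡ y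
⟪⟫-≡ refl = cong (_ ,_) (T-irrelevant _ _)

private
  T-finite : ∀ b → Finite (T b)
  T-finite true  = record { card = 1 ; enum = ↔-sym 1↔⊤ }
  T-finite false = record { card = 0 ; enum = ↔-sym 0↔⊥ }

  ⟪⟫-suc : ∀ {n} (p : Fin (suc n) → Bool) → ⟪ p ⟫ ↔ (T (p zero) ⊎ ⟪ p ∘ suc ⟫)
  ⟪⟫-suc p = mk↔ₛ′
    (λ { (zero , t) → inj₁ t ; (suc i , t) → inj₂ (i , t) })
    (λ { (inj₁ t) → zero , t ; (inj₂ (i , t)) → suc i , t })
    (λ { (inj₁ _) → refl ; (inj₂ _) → refl })
    (λ { (zero , _) → refl ; (suc _ , _) → refl })

  ⟪⟫-Fin-finite : ∀ n (p : Fin n → Bool) → Finite ⟪ p ⟫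
  ⟪⟫-Fin-finite zero    p = record
    { card = 0 ; enum = mk↔ₛ′ (λ ()) (λ ()) (λ ()) (λ ()) }
  ⟪⟫-Fin-finite (suc n) p =
    via (⟪⟫-suc p) (T-finite (p zero) ⊎-finite ⟪⟫-Fin-finite n (p ∘ suc))

⟪⟫-finite : {A : Set} → Finite A → (p : A → Bool) → Finite ⟪ p ⟫
⟪⟫-finite fin p = via
  (mk↔ₛ′
    (λ (x , t) → to x , subst (T ∘ p) (sym (strictlyInverseʳ x)) t)
    (λ (i , t) → from i , t)
    (λ (i , _) → ⟪⟫-≡ (strictlyInverseˡ i))
    (λ (x , _) → ⟪⟫-≡ (strictlyInverseʳ x)))
  (⟪⟫-Fin-finite (card fin) (p ∘ from))
  where open Inverse (enum fin)

------------------------------------------------------------------------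
-- Finite simple graphs

-- Equality of unordered pairs.
infix 4 _≐_
_≐_ : {A : Set} → A × A → A × A → Set
p ≐ q = p ≡ q ⊎ p ≡ swap q

-- The order in which `ends` lists the two endpoints carries no meaning.
record Graph : Set₁ where
  field
    V        : Set
    E        : Set
    V-finite : Finite V
    E-finite : Finite E
    ends     : E → V × V
    loopless : ∀ e → proj₁ (ends e) ≢ proj₂ (ends e)
    simple   : ∀ e f → ends e ≐ ends f → e ≡ f

  order size : ℕ
  order = card V-finite
  size  = card E-finite

  Adjacent : V → V → Set
  Adjacent x y = ∃[ e ] ends e ≐ (x , y)

open Graph using (V; E; order; size)

infix 4 _≅_
record _≅_ (G H : Graph) : Set where
  field
    vertices : V G ↔ V H
    adjacent : ∀ x y → Graph.Adjacent G x y
             ⇔ Graph.Adjacent H (Inverse.to vertices x) (Inverse.to vertices y)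

record Subgraph (G : Graph) : Set where
  open Graph G using (ends)
  field
    hasV   : V G → Bool
    hasE   : E G → Bool
    closed : ∀ e → T (hasE e) → T (hasV (proj₁ (ends e))) × T (hasV (proj₂ (ends e)))

open Subgraph using (hasE)

asGraph : {G : Graph} → Subgraph G → Graph
asGraph {G} S = record
  { V        = ⟪ hasV ⟫
  ; E        = ⟪ hasE S ⟫
  ; V-finite = ⟪⟫-finite V-finite hasV
  ; E-finite = ⟪⟫-finite E-finite (hasE S)
  ; ends     = λ (e , t) → (proj₁ (ends e) , proj₁ (closed e t))
                         , (proj₂ (ends e) , proj₂ (closed e t))
  ; loopless = λ (e , _) eq → loopless e (cong proj₁ eq)
  ; simple   = λ (e , _) (f , _) eq → ⟪⟫-≡ (simple e f (forget eq))
  }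
  where
  open Graph G
  open Subgraph S using (hasV; closed)
  forget : {p q : ⟪ hasV ⟫ × ⟪ hasV ⟫} → p ≐ q →
           (proj₁ (proj₁ p) , proj₁ (proj₂ p)) ≐ (proj₁ (proj₁ q) , proj₁ (proj₂ q))
  forget (inj₁ refl) = inj₁ refl
  forget (inj₂ refl) = inj₂ refl

------------------------------------------------------------------------
-- Coverings and magic labelings

HasCovering : Graph → Graph → Set
HasCovering H G = ∀ e → Σ (Subgraph G) λ S → T (hasE S e) × asGraph S ≅ H

weight : {G : Graph} → (V G ⊎ E G → ℕ) → Subgraph G → ℕ
weight f S = ∑ (Graph.V-finite (asGraph S)) (λ v → f (inj₁ (proj₁ v)))
           + ∑ (Graph.E-finite (asGraph S)) (λ e → f (inj₂ (proj₁ e)))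

record MagicLabeling (H G : Graph) : Set where
  field
    bijection : (V G ⊎ E G) ⤖ Fin (order G + size G)

  -- Labels are 1, …, |V| + |E|, whereas Fin counts from 0.
  label : V G ⊎ E G → ℕ
  label x = suc (toℕ (Bijection.to bijection x))

  field
    constant : ∃[ c ] ∀ (S : Subgraph G) → asGraph S ≅ H → weight label S ≡ c

IsSupermagicLabeling : {H G : Graph} → MagicLabeling H G → Set
IsSupermagicLabeling {G = G} L =
  ∀ k → (∃[ v ] label (inj₁ v) ≡ k) ⇔ (1 ≤ k × k ≤ order G)
  where open MagicLabeling L

Supermagic : Graph → Graph → Set
Supermagic H G = HasCovering H G × Σ (MagicLabeling H G) IsSupermagicLabeling

------------------------------------------------------------------------
-- Cycles

-- Edge 0 closes the cycle; edge i + 1 joins i and i + 1.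
cycleEnds : ∀ {k} → Fin k → Fin k × Fin k
cycleEnds {suc k} zero    = fromℕ k , zero
cycleEnds {suc k} (suc i) = inject₁ i , suc i

private
  inject₁≢suc : ∀ {n} (i : Fin n) → inject₁ i ≢ suc i
  inject₁≢suc zero    ()
  inject₁≢suc (suc i) eq = inject₁≢suc i (suc-injective eq)

  crossed : ∀ {n} (i j : Fin n) → inject₁ i ≡ suc j → suc i ≢ inject₁ j
  crossed zero    j       ()
  crossed (suc i) zero    _  ()
  crossed (suc i) (suc j) p  q = crossed i j (suc-injective p) (suc-injective q)

  cycle-loopless : ∀ {k} → 3 ≤ k → (e : Fin k) →
                   proj₁ (cycleEnds e) ≢ proj₂ (cycleEnds e)
  cycle-loopless (s≤s (s≤s (s≤s _))) zero    ()
  cycle-loopless (s≤s (s≤s (s≤s _))) (suc i) = inject₁≢suc i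

  cycle-simple : ∀ {k} → 3 ≤ k → (e f : Fin k) → cycleEnds e ≐ cycleEnds f → e ≡ f
  cycle-simple _ zero zero _ = refl
  cycle-simple (s≤s (s≤s (s≤s _))) zero (suc j) (inj₁ eq) = ⊥-elim (fromℕ≢inject₁ (cong proj₁ eq))
  cycle-simple (s≤s (s≤s (s≤s _))) zero (suc zero) (inj₂ ())
  cycle-simple (s≤s (s≤s (s≤s _))) zero (suc (suc j)) (inj₂ ())
  cycle-simple (s≤s (s≤s (s≤s _))) (suc i) zero (inj₁ eq) = ⊥-elim (fromℕ≢inject₁ (sym (cong proj₁ eq)))
  cycle-simple (s≤s (s≤s (s≤s _))) (suc zero) zero (inj₂ ())
  cycle-simple (s≤s (s≤s (s≤s _))) (suc (suc i)) zero (inj₂ ())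
  cycle-simple (s≤s _) (suc i) (suc j) (inj₁ eq) = cong proj₂ eq
  cycle-simple (s≤s _) (suc i) (suc j) (inj₂ eq) =
    ⊥-elim (crossed i j (cong proj₁ eq) (cong proj₂ eq))

Cycle : (k : ℕ) → 3 ≤ k → Graph
Cycle k 3≤k = record
  { V        = Fin k
  ; E        = Fin k
  ; V-finite = Fin-finite k
  ; E-finite = Fin-finite k
  ; ends     = cycleEnds
  ; loopless = cycle-loopless 3≤k
  ; simple   = cycle-simple 3≤k
  }

C₃ : Graph
C₃ = Cycle 3 ≤-refl

------------------------------------------------------------------------
-- Triangular ladders

data LadderV (n : ℕ) : Set where
  u v : Fin n → LadderV n

data LadderE (n : ℕ) : Set where
  uv       : Fin n → LadderE n
  uu vv vu : Fin (pred n) → LadderE n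

-- The indices i and i + 1, for 1 ≤ i ≤ n - 1.
this next : ∀ {n} → Fin (pred n) → Fin n
this {suc n} i = inject₁ i
next {suc n} i = suc i

ladderEnds : ∀ {n} → LadderE n → LadderV n × LadderV n
ladderEnds (uv i) = u i        , v i
ladderEnds (uu i) = u (this i) , u (next i)
ladderEnds (vv i) = v (this i) , v (next i)
ladderEnds (vu i) = v (this i) , u (next i)

private
  LadderV-finite : ∀ n → Finite (LadderV n)
  LadderV-finite n = via
    (mk↔ₛ′
      (λ { (u i) → inj₁ i ; (v i) → inj₂ i })
      (λ { (inj₁ i) → u i ; (inj₂ i) → v i })
      (λ { (inj₁ _) → refl ; (inj₂ _) → refl })
      (λ { (u _) → refl ; (v _) → refl }))
    (Fin-finite n ⊎-finite Fin-finite n)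

  LadderE-finite : ∀ n → Finite (LadderE n)
  LadderE-finite n = via
    (mk↔ₛ′
      (λ { (uv i) → inj₁ i ; (uu i) → inj₂ (inj₁ i)
         ; (vv i) → inj₂ (inj₂ (inj₁ i)) ; (vu i) → inj₂ (inj₂ (inj₂ i)) })
      (λ { (inj₁ i) → uv i ; (inj₂ (inj₁ i)) → uu i
         ; (inj₂ (inj₂ (inj₁ i))) → vv i ; (inj₂ (inj₂ (inj₂ i))) → vu i })
      (λ { (inj₁ _) → refl ; (inj₂ (inj₁ _)) → refl
         ; (inj₂ (inj₂ (inj₁ _))) → refl ; (inj₂ (inj₂ (inj₂ _))) → refl })
      (λ { (uv _) → refl ; (uu _) → refl ; (vv _) → refl ; (vu _) → refl }))
    (Fin-finite n ⊎-finite
     Fin-finite (pred n) ⊎-finite Fin-finite (pred n) ⊎-finite Fin-finite (pred n))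

  -- ladderEnds lists endpoints in the order u₁, v₁, u₂, v₂, …
  rank : ∀ {n} → LadderV n → ℕ
  rank (u i) = toℕ i + toℕ i
  rank (v i) = suc (toℕ i + toℕ i)

  this<next : ∀ n (i : Fin (pred n)) → toℕ (this {n} i) < toℕ (next {n} i)
  this<next (suc n) i rewrite toℕ-inject₁ i = n<1+n (toℕ i)

  double< : ∀ {a b} → a < b → a + a < b + b
  double< a<b = +-mono-< a<b a<b

  double<₁ : ∀ {a b} → a < b → suc (a + a) < b + b
  double<₁ {a} {suc b} (s≤s a≤b) rewrite +-suc b b = s≤s (s≤s (+-mono-≤ a≤b a≤b))

  ascending : ∀ {n} (e : LadderE n) →
              rank (proj₁ (ladderEnds e)) < rank (proj₂ (ladderEnds e))
  ascending     (uv i) = n<1+n _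
  ascending {n} (uu i) = double< (this<next n i)
  ascending {n} (vv i) = s≤s (double< (this<next n i))
  ascending {n} (vu i) = double<₁ (this<next n i)

  u-injective : ∀ {n} {i j : Fin n} → u i ≡ u j → i ≡ j
  u-injective refl = refl

  v-injective : ∀ {n} {i j : Fin n} → v i ≡ v j → i ≡ j
  v-injective refl = refl

  next-injective : ∀ {n} (i j : Fin (pred n)) → next {n} i ≡ next {n} j → i ≡ j
  next-injective {suc n} i j = suc-injective

  ladderEnds-injective : ∀ {n} (e f : LadderE n) → ladderEnds e ≡ ladderEnds f → e ≡ f
  ladderEnds-injective (uv i) (uv j) eq = cong uv (u-injective (cong proj₁ eq))
  ladderEnds-injective (uu i) (uu j) eq = cong uu (next-injective i j (u-injective (cong proj₂ eq)))
  ladderEnds-injective (vv i) (vv j) eq = cong vv (next-injective i j (v-injective (cong proj₂ eq)))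
  ladderEnds-injective (vu i) (vu j) eq = cong vu (next-injective i j (u-injective (cong proj₂ eq)))
  ladderEnds-injective (uv i) (uu j) eq with () ← cong proj₂ eq
  ladderEnds-injective (uv i) (vv j) eq with () ← cong proj₁ eq
  ladderEnds-injective (uv i) (vu j) eq with () ← cong proj₁ eq
  ladderEnds-injective (uu i) (uv j) eq with () ← cong proj₂ eq
  ladderEnds-injective (uu i) (vv j) eq with () ← cong proj₁ eq
  ladderEnds-injective (uu i) (vu j) eq with () ← cong proj₁ eq
  ladderEnds-injective (vv i) (uv j) eq with () ← cong proj₁ eq
  ladderEnds-injective (vv i) (uu j) eq with () ← cong proj₁ eq
  ladderEnds-injective (vv i) (vu j) eq with () ← cong proj₂ eq
  ladderEnds-injective (vu i) (uv j) eq with () ← cong proj₁ eq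
  ladderEnds-injective (vu i) (uu j) eq with () ← cong proj₁ eq
  ladderEnds-injective (vu i) (vv j) eq with () ← cong proj₂ eq

  ladder-simple : ∀ {n} (e f : LadderE n) → ladderEnds e ≐ ladderEnds f → e ≡ f
  ladder-simple e f (inj₁ eq) = ladderEnds-injective e f eq
  ladder-simple e f (inj₂ eq) = ⊥-elim (<-asym (ascending f)
    (subst (λ p → rank (proj₁ p) < rank (proj₂ p)) eq (ascending e)))

TL : ℕ → Graph
TL n = record
  { V        = LadderV n
  ; E        = LadderE n
  ; V-finite = LadderV-finite n
  ; E-finite = LadderE-finite n
  ; ends     = ladderEnds
  ; loopless = λ e eq → <-irrefl (cong rank eq) (ascending e)
  ; simple   = ladder-simple
  }

------------------------------------------------------------------------
-- Disjoint unions of copies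

infixr 7 _·_
_·_ : ℕ → Graph → Graph
m · G = record
  { V        = Fin m × V G
  ; E        = Fin m × E G
  ; V-finite = Fin-finite m ×-finite V-finite
  ; E-finite = Fin-finite m ×-finite E-finite
  ; ends     = λ (i , e) → (i , proj₁ (ends e)) , (i , proj₂ (ends e))
  ; loopless = λ (_ , e) eq → loopless e (cong proj₂ eq)
  ; simple   = distinct
  }
  where
  open Graph G using (V-finite; E-finite; ends; loopless; simple)
  distinct : (e f : Fin m × E G) →
             ((proj₁ e , proj₁ (ends (proj₂ e))) , (proj₁ e , proj₂ (ends (proj₂ e))))
             ≐ ((proj₁ f , proj₁ (ends (proj₂ f))) , (proj₁ f , proj₂ (ends (proj₂ f)))) →
             e ≡ f
  distinct (i , e) (j , f) (inj₁ eq) = cong₂ _,_ (cong (proj₁ ∘ proj₁) eq)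
    (simple e f (inj₁ (cong (λ (x , y) → proj₂ x , proj₂ y) eq)))
  distinct (i , e) (j , f) (inj₂ eq) = cong₂ _,_ (cong (proj₁ ∘ proj₁) eq)
    (simple e f (inj₂ (cong (λ (x , y) → proj₂ x , proj₂ y) eq)))

{-# OPTIONS --safe #-}
-- Reading the vertices of TLₙ as w₀, …, w₂ₙ₋₁ = u₁, v₁, u₂, v₂, … turns it into the
-- square of a path: w_r is joined to w_{r+1} by an edge a_r and to w_{r+2} by an edge
-- b_r, and the triangles are {w_r, w_{r+1}, w_{r+2}}, with edges a_r, a_{r+1}, b_r.
-- Give w_r the position r, a_r the position r, and b_r the position K + r, where
-- K = 2n - 1 is the number of edges a_r.  In every triangle the vertex positions then
-- exceed the edge positions by 2 - K in total.  In m copies, number the vertices by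
-- m · position + copy in increasing order and the edges by the same formula in
-- decreasing order: a triangle has as many vertices as edges, so both the position
-- and the copy cancel.
module Submission where

open import Defs
open import Algebra.Properties.CommutativeMonoid.Sum using (sum-permute)
open import Algebra.Properties.Monoid.Sum using (sum-cong-≗)
open import Data.Bool.Base using (T)
open import Data.Empty using (⊥-elim)
open import Data.Fin.Base using (Fin; zero; suc; toℕ; fromℕ<; inject₁; combine; opposite)
open import Data.Fin.Patterns using (0F; 1F; 2F)
open import Data.Fin.Permutation using (cast-id; reverse; ↔⇒≡)
open import Data.Fin.Properties
  using (toℕ-inject₁; toℕ-cast; toℕ-combine; toℕ-↑ˡ; toℕ-↑ʳ; toℕ<n; toℕ-fromℕ<;
         opposite-prop; any?; inj⇒≟; +↔⊎; *↔×)
open import Data.Nat.Base using (ℕ; suc; _+_; _*_; _∸_; _≤_; s≤s; z≤n)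
open import Data.Nat.Properties
  using (+-0-commutativeMonoid; +-0-monoid; +-suc; +-assoc; *-zeroʳ; *-identityʳ; m∸n+n≡m; m+n∸n≡m)
open import Data.Nat.Tactic.RingSolver using (solve-∀)
open import Data.Product.Algebra using (×-comm)
open import Data.Product.Base using (Σ; ∃; _×_; _,_; proj₁; proj₂; map)
open import Data.Product.Function.NonDependent.Propositional using (_×-↔_)
open import Data.Sum.Base using (_⊎_; inj₁; inj₂; [_,_]′)
open import Data.Sum.Function.Propositional using (_⊎-↔_)
open import Function.Base using (_∘_)
open import Function.Bundles using (_↔_; mk↔ₛ′; mk⇔; Inverse; Equivalence)
open import Function.Definitions using (Injective)
open import Function.Properties.Inverse using (↔-refl; ↔-sym; ↔-trans; ↔⇒↣; ↔⇒⤖)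
open import Relation.Binary.Definitions using (DecidableEquality)
open import Relation.Binary.PropositionalEquality
  using (_≡_; _≢_; _≗_; refl; sym; trans; cong; cong₂; subst; subst₂; module ≡-Reasoning)
open import Relation.Nullary.Decidable using (Dec; map′; ⌊_⌋; toWitness; fromWitness)
open import Relation.Unary using (Decidable)

open Graph using (V; E; order; size; V-finite; E-finite; ends)
open Inverse using (to; from; strictlyInverseˡ; strictlyInverseʳ)

-- Finite types

∑-cong : {A : Set} (fin : Finite A) {f g : A → ℕ} → f ≗ g → ∑ fin f ≡ ∑ fin g
∑-cong fin eq = sum-cong-≗ +-0-monoid (λ k → eq (from (enum fin) k))

-- Enumerating `A` directly or through `i` and `B` differs only by a permutation of indices, which a
-- commutative sum ignores.
∑-transport : {A B : Set} (finA : Finite A) (finB : Finite B) (i : A ↔ B) (f : A → ℕ) →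
              ∑ finA f ≡ ∑ finB (f ∘ from i)
∑-transport finA finB i f = trans
  (sum-permute +-0-commutativeMonoid (f ∘ from (enum finA))
    (↔-trans (↔-sym (enum finB)) (↔-trans (↔-sym i) (enum finA))))
  (∑-cong finB (λ y → cong f (strictlyInverseʳ (enum finA) (from i y))))

anyFinite? : {A : Set} {P : A → Set} → Finite A → Decidable P → Dec (∃ P)
anyFinite? {P = P} fin P? = map′
  (λ (k , p) → from (enum fin) k , p)
  (λ (x , p) → to (enum fin) x , subst P (sym (strictlyInverseʳ (enum fin) x)) p)
  (any? (P? ∘ from (enum fin)))

finite⇒≟ : {A : Set} → Finite A → DecidableEquality A
finite⇒≟ fin = inj⇒≟ (↔⇒↣ (enum fin))

-- A convenient numbering lands in `Fin p` with `p` in another form than `card fin`. Both count `A`,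
-- so they agree without any arithmetic.
recount : {A : Set} {p : ℕ} (fin : Finite A) → A ↔ Fin p → A ↔ Fin (card fin)
recount fin i = ↔-trans i (cast-id (↔⇒≡ (↔-trans (↔-sym i) (enum fin))))

toℕ-recount : {A : Set} {p : ℕ} (fin : Finite A) (i : A ↔ Fin p) (x : A) →
              toℕ (to (recount fin i) x) ≡ toℕ (to i x)
toℕ-recount fin i x = toℕ-cast _ (to i x)

-- Unordered pairs

≐-sym : {A : Set} {p q : A × A} → p ≐ q → q ≐ p
≐-sym (inj₁ refl) = inj₁ refl
≐-sym (inj₂ refl) = inj₂ refl

≐-trans : {A : Set} {p q r : A × A} → p ≐ q → q ≐ r → p ≐ r
≐-trans (inj₁ refl) q≐r         = q≐r
≐-trans (inj₂ refl) (inj₁ refl) = inj₂ refl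
≐-trans (inj₂ refl) (inj₂ refl) = inj₁ refl

≐-map : {A B : Set} (f : A → B) {p q : A × A} → p ≐ q → map f f p ≐ map f f q
≐-map f (inj₁ refl) = inj₁ refl
≐-map f (inj₂ refl) = inj₂ refl

≐-map-injective : {A B : Set} {f : A → B} → Injective _≡_ _≡_ f →
                  {p q : A × A} → map f f p ≐ map f f q → p ≐ q
≐-map-injective inj (inj₁ eq) = inj₁ (cong₂ _,_ (inj (cong proj₁ eq)) (inj (cong proj₂ eq)))
≐-map-injective inj (inj₂ eq) = inj₂ (cong₂ _,_ (inj (cong proj₁ eq)) (inj (cong proj₂ eq)))

-- Isomorphisms

≅-sym : {G H : Graph} → G ≅ H → H ≅ G
≅-sym {G} {H} φ = record
  { vertices = ↔-sym vertices
  ; adjacent = λ x y →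
      let x≡ = strictlyInverseˡ vertices x
          y≡ = strictlyInverseˡ vertices y
          eqv = adjacent (from vertices x) (from vertices y)
      in mk⇔
        (Equivalence.from eqv ∘ subst₂ (Graph.Adjacent H) (sym x≡) (sym y≡))
        (subst₂ (Graph.Adjacent H) x≡ y≡ ∘ Equivalence.to eqv)
  }
  where open _≅_ φ

module _ {G H : Graph} (φ : G ≅ H) where
  open _≅_ φ

  -- `_≅_` speaks of vertices and adjacency only. The edge map is recovered by sending the adjacency
  -- that `e` itself witnesses through the equivalence.
  edgeTo : E G → E H
  edgeTo e = proj₁ (Equivalence.to (adjacent _ _) (e , inj₁ refl))

  ends-edgeTo : ∀ e → ends H (edgeTo e) ≐ map (to vertices) (to vertices) (ends G e)
  ends-edgeTo e = proj₂ (Equivalence.to (adjacent _ _) (e , inj₁ refl))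

-- The round trip gives an edge with the same unordered ends as `e`, and in a simple graph the ends
-- determine the edge.
edgeTo-inverse : {G H : Graph} (φ : G ≅ H) → ∀ e → edgeTo φ (edgeTo (≅-sym φ) e) ≡ e
edgeTo-inverse {G} {H} φ e = Graph.simple H _ _
  (≐-trans (ends-edgeTo φ (edgeTo (≅-sym φ) e))
  (≐-trans (≐-map (to vertices) (ends-edgeTo (≅-sym φ) e))
           (inj₁ (cong₂ _,_ (strictlyInverseˡ vertices _) (strictlyInverseˡ vertices _)))))
  where open _≅_ φ

edges : {G H : Graph} → G ≅ H → E G ↔ E H
edges {G} {H} φ = mk↔ₛ′ (edgeTo φ) (edgeTo (≅-sym φ)) (edgeTo-inverse φ)
  (λ e → Graph.simple G _ _
    (≐-trans (ends-edgeTo (≅-sym φ) (edgeTo φ e))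
    (≐-trans (≐-map (from vertices) (ends-edgeTo φ e))
             (inj₁ (cong₂ _,_ (strictlyInverseʳ vertices _) (strictlyInverseʳ vertices _))))))
  where open _≅_ φ

-- Moves the sums from an arbitrary subgraph to the fixed graph `H`; for `C₃` they become explicit
-- three-term sums.
weight-≅ : {G H : Graph} (f : V G ⊎ E G → ℕ) (S : Subgraph G) (φ : asGraph S ≅ H) →
           weight f S ≡ ∑ (V-finite H) (f ∘ inj₁ ∘ proj₁ ∘ from (_≅_.vertices φ))
                      + ∑ (E-finite H) (f ∘ inj₂ ∘ proj₁ ∘ from (edges φ))
weight-≅ {G} {H} f S φ = cong₂ _+_
  (∑-transport (V-finite (asGraph S)) (V-finite H) (_≅_.vertices φ) (f ∘ inj₁ ∘ proj₁))
  (∑-transport (E-finite (asGraph S)) (E-finite H) (edges φ) (f ∘ inj₂ ∘ proj₁))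

-- Embeddings and coverings

record Embedding (H G : Graph) : Set where
  field
    onV       : V H → V G
    onE       : E H → E G
    injective : Injective _≡_ _≡_ onV
    ends-onE  : ∀ e → ends G (onE e) ≐ map onV onV (ends H e)

module _ {H G : Graph} (ε : Embedding H G) where
  open Embedding ε

  inImageV? : Decidable (λ y → ∃ λ x → onV x ≡ y)
  inImageV? y = anyFinite? (V-finite H) (λ x → finite⇒≟ (V-finite G) (onV x) y)

  inImageE? : Decidable (λ e → ∃ λ d → onE d ≡ e)
  inImageE? e = anyFinite? (E-finite H) (λ d → finite⇒≟ (E-finite G) (onE d) e)

  image : Subgraph G
  image = record
    { hasV   = λ y → ⌊ inImageV? y ⌋
    ; hasE   = λ e → ⌊ inImageE? e ⌋
    ; closed = closed
    }
    where
    closed : ∀ e → T ⌊ inImageE? e ⌋ →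
             T ⌊ inImageV? (proj₁ (ends G e)) ⌋ × T ⌊ inImageV? (proj₂ (ends G e)) ⌋
    closed e t with toWitness {a? = inImageE? e} t
    ... | d , refl with ends-onE d
    ...   | inj₁ eq = fromWitness (_ , sym (cong proj₁ eq)) , fromWitness (_ , sym (cong proj₂ eq))
    ...   | inj₂ eq = fromWitness (_ , sym (cong proj₁ eq)) , fromWitness (_ , sym (cong proj₂ eq))

  -- Every edge of the image is some `onE d`, and injectivity of `onV` recovers the ends of `d` from
  -- those of `onE d`.
  image-≅ : asGraph image ≅ H
  image-≅ = record { vertices = vs ; adjacent = λ x y → mk⇔ (adj⁺ x y) (adj⁻ x y) }
    where
    I = asGraph image

    preimage : (y : V I) → ∃ λ x → onV x ≡ proj₁ y
    preimage (y , t) = toWitness {a? = inImageV? y} t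

    vs : V I ↔ V H
    vs = mk↔ₛ′ (proj₁ ∘ preimage) (λ x → onV x , fromWitness (x , refl))
      (λ x → injective (proj₂ (preimage (onV x , _))))
      (λ y → ⟪⟫-≡ (proj₂ (preimage y)))

    onV-preimages : ∀ x y → map onV onV (to vs x , to vs y) ≡ (proj₁ x , proj₁ y)
    onV-preimages x y = cong₂ _,_ (proj₂ (preimage x)) (proj₂ (preimage y))

    adj⁺ : ∀ x y → Graph.Adjacent I x y → Graph.Adjacent H (to vs x) (to vs y)
    adj⁺ x y ((e , t) , eq) with toWitness {a? = inImageE? e} t
    ... | d , refl = d , ≐-map-injective injective
      (≐-trans (≐-sym (ends-onE d))
      (≐-trans (≐-map proj₁ eq)
               (inj₁ (sym (onV-preimages x y)))))

    adj⁻ : ∀ x y → Graph.Adjacent H (to vs x) (to vs y) → Graph.Adjacent I x y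
    adj⁻ x y (d , eq) = (onE d , fromWitness (d , refl)) , ≐-map-injective ⟪⟫-≡
      (≐-trans (ends-onE d)
      (≐-trans (≐-map onV eq)
               (inj₁ (onV-preimages x y))))

-- Unlike subgraphs given by Boolean functions, embeddings pass to `m · G` just by attaching a copy
-- index.
EmbeddingsCover : Graph → Graph → Set
EmbeddingsCover H G = ∀ e → Σ (Embedding H G) λ ε → ∃ λ d → Embedding.onE ε d ≡ e

embeddingsCover⇒covering : {H G : Graph} → EmbeddingsCover H G → HasCovering H G
embeddingsCover⇒covering cover e =
  let ε , d , eq = cover e in image ε , fromWitness (d , eq) , image-≅ ε

inCopy : {H G : Graph} {m : ℕ} → Fin m → Embedding H G → Embedding H (m · G)
inCopy i ε = record
  { onV       = λ x → i , onV x
  ; onE       = λ e → i , onE e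
  ; injective = injective ∘ cong proj₂
  ; ends-onE  = ≐-map (i ,_) ∘ ends-onE
  }
  where open Embedding ε

copies-cover : {H G : Graph} {m : ℕ} → EmbeddingsCover H G → EmbeddingsCover H (m · G)
copies-cover cover (i , e) = let ε , d , eq = cover e in inCopy i ε , d , cong (i ,_) eq

-- Triangles and the covering of the ladder

ends-distinct : (G : Graph) {e : E G} {x y : V G} → ends G e ≐ (x , y) → x ≢ y
ends-distinct G {e} (inj₁ refl) = Graph.loopless G e
ends-distinct G {e} (inj₂ refl) = Graph.loopless G e ∘ sym

-- Any two vertices of `C₃` are adjacent, so the absence of loops in `G` already makes the three
-- vertices distinct.
triangle : {G : Graph} (x : Fin 3 → V G) (e : Fin 3 → E G) →
           (∀ k → ends G (e k) ≐ map x x (cycleEnds k)) → Embedding C₃ G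
triangle {G} x e ends-e = record
  { onV = x ; onE = e ; injective = inj _ _ ; ends-onE = ends-e }
  where
  -- `cycleEnds` lists the pairs (2,0), (0,1), (1,2), which settles all unequal cases of `inj`.
  distinct : ∀ k → proj₁ (map x x (cycleEnds k)) ≢ proj₂ (map x x (cycleEnds k))
  distinct k = ends-distinct G {e k} (ends-e k)

  inj : ∀ i j → x i ≡ x j → i ≡ j
  inj 0F 0F _  = refl
  inj 0F 1F eq = ⊥-elim (distinct 1F eq)
  inj 0F 2F eq = ⊥-elim (distinct 0F (sym eq))
  inj 1F 0F eq = ⊥-elim (distinct 1F (sym eq))
  inj 1F 1F _  = refl
  inj 1F 2F eq = ⊥-elim (distinct 2F eq)
  inj 2F 0F eq = ⊥-elim (distinct 0F eq)
  inj 2F 1F eq = ⊥-elim (distinct 2F (sym eq))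
  inj 2F 2F _  = refl

module _ {k : ℕ} (i : Fin k) where

  lowerTriangle upperTriangle : Embedding C₃ (TL (suc k))
  lowerTriangle = triangle
    (λ { 0F → u (inject₁ i) ; 1F → v (inject₁ i) ; 2F → u (suc i) })
    (λ { 0F → uu i ; 1F → uv (inject₁ i) ; 2F → vu i })
    -- Edge 0 of the cycle goes from the last vertex back to the first, against the order in
    -- `ladderEnds`.
    (λ { 0F → inj₂ refl ; 1F → inj₁ refl ; 2F → inj₁ refl })
  upperTriangle = triangle
    (λ { 0F → v (inject₁ i) ; 1F → u (suc i) ; 2F → v (suc i) })
    (λ { 0F → vv i ; 1F → vu i ; 2F → uv (suc i) })
    (λ { 0F → inj₂ refl ; 1F → inj₁ refl ; 2F → inj₁ refl })

-- Rung zero takes the lower triangle at zero, which exists because there are at least two rungs;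
-- every later rung closes an upper triangle.
ladder-cover : ∀ k → EmbeddingsCover C₃ (TL (2 + k))
ladder-cover k (uv zero)    = lowerTriangle zero , 1F , refl
ladder-cover k (uv (suc i)) = upperTriangle i , 2F , refl
ladder-cover k (uu i)       = lowerTriangle i , 0F , refl
ladder-cover k (vv i)       = upperTriangle i , 0F , refl
ladder-cover k (vu i)       = lowerTriangle i , 2F , refl

-- Labelings that number the vertices before the edges

module _ {G : Graph} (α : V G ↔ Fin (order G)) (β : E G ↔ Fin (size G)) where

  -- The labels as plain numbers, so that weights can be computed without the injections into
  -- `Fin (order G + size G)`.
  verticesFirst : V G ⊎ E G → ℕ
  verticesFirst = [ (λ x → suc (toℕ (to α x))) , (λ e → suc (order G + toℕ (to β e))) ]′

  verticesFirst-supermagic : {H : Graph} → HasCovering H G →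
    (∃ λ c → ∀ (S : Subgraph G) → asGraph S ≅ H → weight verticesFirst S ≡ c) →
    Supermagic H G
  verticesFirst-supermagic {H} cover (c , weight≡c) = cover , L , vertexLabels
    where
    bij : (V G ⊎ E G) ↔ Fin (order G + size G)
    bij = ↔-trans (α ⊎-↔ β) (↔-sym +↔⊎)

    label-vertex : ∀ x → suc (toℕ (to bij (inj₁ x))) ≡ verticesFirst (inj₁ x)
    label-vertex x = cong suc (toℕ-↑ˡ (to α x) (size G))

    label-edge : ∀ e → suc (toℕ (to bij (inj₂ e))) ≡ verticesFirst (inj₂ e)
    label-edge e = cong suc (toℕ-↑ʳ (order G) (to β e))

    L : MagicLabeling H G
    L = record
      { bijection = ↔⇒⤖ bij
      ; constant  = c , λ S φ → trans
          (cong₂ _+_ (∑-cong (V-finite (asGraph S)) (label-vertex ∘ proj₁))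
                     (∑-cong (E-finite (asGraph S)) (label-edge ∘ proj₁)))
          (weight≡c S φ)
      }

    vertexLabels : IsSupermagicLabeling L
    vertexLabels k = mk⇔ bounded attained
      where
      bounded : (∃ λ x → suc (toℕ (to bij (inj₁ x))) ≡ k) → 1 ≤ k × k ≤ order G
      bounded (x , refl) = s≤s z≤n , subst (_≤ order G) (sym (label-vertex x)) (toℕ<n (to α x))

      attained : 1 ≤ k × k ≤ order G → ∃ λ x → suc (toℕ (to bij (inj₁ x))) ≡ k
      -- Labels start at 1, so `k≤` is exactly the bound that makes the predecessor of `k` a value
      -- of `α`.
      attained (s≤s _ , k≤) = x , trans (label-vertex x)
        (cong suc (trans (cong toℕ (strictlyInverseˡ α (fromℕ< k≤))) (toℕ-fromℕ< k≤)))
        where x = from α (fromℕ< k≤)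

-- Positions in the ladder

position : ∀ {n} → LadderV n → ℕ
position (u i) = toℕ i * 2
position (v i) = suc (toℕ i * 2)

module _ (k : ℕ) where

  -- For n = k + 1 this is K = 2n - 1: n rungs `uv` and n - 1 diagonals `vu`.
  shortEdges : ℕ
  shortEdges = suc (k * 2)

  edgePosition : LadderE (suc k) → ℕ
  edgePosition (uv i) = toℕ i * 2
  edgePosition (vu i) = suc (toℕ i * 2)
  edgePosition (uu i) = shortEdges + toℕ i * 2
  edgePosition (vv i) = shortEdges + suc (toℕ i * 2)

vertexIndex : ∀ n → LadderV n ↔ Fin (n * 2)
vertexIndex n = ↔-trans
  (mk↔ₛ′
    (λ { (u i) → i , 0F ; (v i) → i , 1F })
    (λ { (i , 0F) → u i ; (i , 1F) → v i })
    (λ { (_ , 0F) → refl ; (_ , 1F) → refl })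
    (λ { (u _) → refl ; (v _) → refl }))
  (↔-sym *↔×)

toℕ-combine₂ : ∀ {n} (i : Fin n) (b : Fin 2) → toℕ (combine i b) ≡ toℕ b + toℕ i * 2
toℕ-combine₂ i b = trans (toℕ-combine i b) (rearrange (toℕ i) (toℕ b))
  where
  rearrange : ∀ i b → 2 * i + b ≡ b + i * 2
  rearrange = solve-∀

toℕ-vertexIndex : ∀ n x → toℕ (to (vertexIndex n) x) ≡ position x
toℕ-vertexIndex n (u i) = toℕ-combine₂ i 0F
toℕ-vertexIndex n (v i) = toℕ-combine₂ i 1F

-- Apart from uv zero at position 0, edges are coded by (long or short, i, parity).
edgeCode : ∀ k → LadderE (suc k) ↔ (Fin 1 ⊎ Fin 2 × Fin k × Fin 2)
edgeCode k = mk↔ₛ′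
  (λ { (uv zero)    → inj₁ 0F
     ; (uv (suc i)) → inj₂ (0F , i , 1F)
     ; (vu i)       → inj₂ (0F , i , 0F)
     ; (uu i)       → inj₂ (1F , i , 0F)
     ; (vv i)       → inj₂ (1F , i , 1F) })
  (λ { (inj₁ 0F)            → uv zero
     ; (inj₂ (0F , i , 1F)) → uv (suc i)
     ; (inj₂ (0F , i , 0F)) → vu i
     ; (inj₂ (1F , i , 0F)) → uu i
     ; (inj₂ (1F , i , 1F)) → vv i })
  (λ { (inj₁ 0F)            → refl
     ; (inj₂ (0F , _ , 1F)) → refl
     ; (inj₂ (0F , _ , 0F)) → refl
     ; (inj₂ (1F , _ , 0F)) → refl
     ; (inj₂ (1F , _ , 1F)) → refl })
  (λ { (uv zero)    → refl
     ; (uv (suc _)) → refl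
     ; (vu _)       → refl
     ; (uu _)       → refl
     ; (vv _)       → refl })

edgeIndex : ∀ k → LadderE (suc k) ↔ Fin (1 + 2 * (k * 2))
edgeIndex k = ↔-trans (edgeCode k)
  (↔-trans (↔-refl ⊎-↔ ↔-trans (↔-refl ×-↔ ↔-sym *↔×) (↔-sym *↔×)) (↔-sym +↔⊎))

-- After position 0, the short edges fill 1 to 2k and the long ones 2k + 1 to 4k; hence the outer
-- `suc` and the block offsets 0 and 2k.
toℕ-edgeIndex : ∀ k e → toℕ (to (edgeIndex k) e) ≡ edgePosition k e
toℕ-edgeIndex k = λ
  { (uv zero)    → refl
  ; (uv (suc i)) → cong suc (code 0F i 1F (*-zeroʳ (k * 2)))
  ; (vu i)       → cong suc (code 0F i 0F (*-zeroʳ (k * 2)))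
  ; (uu i)       → cong suc (code 1F i 0F (*-identityʳ (k * 2)))
  ; (vv i)       → cong suc (code 1F i 1F (*-identityʳ (k * 2)))
  }
  where
  code : ∀ (l : Fin 2) (i : Fin k) (b : Fin 2) {offset : ℕ} → k * 2 * toℕ l ≡ offset →
         toℕ (combine l (combine i b)) ≡ offset + (toℕ b + toℕ i * 2)
  code l i b eq = trans (toℕ-combine l (combine i b)) (cong₂ _+_ eq (toℕ-combine₂ i b))

-- Link K a b p: positions a and b are joined by an edge at position p.
data Link (K : ℕ) : ℕ → ℕ → ℕ → Set where
  short  : ∀ {a} → Link K a (1 + a) a
  short˘ : ∀ {a} → Link K (1 + a) a a
  long   : ∀ {a} → Link K a (2 + a) (K + a)
  long˘  : ∀ {a} → Link K (2 + a) a (K + a)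

Link-sym : ∀ {K a b p} → Link K a b p → Link K b a p
Link-sym short  = short˘
Link-sym short˘ = short
Link-sym long   = long˘
Link-sym long˘  = long

-- The steps ±1 and ±2 around a triangle add up to zero, so one link is long and the two short ones
-- run the other way. This leaves six cases, the orderings of three consecutive positions. Keeping 2
-- and `K` on opposite sides avoids subtraction.
triangle-positions : ∀ {K a b c p q r} → Link K c a p → Link K a b q → Link K b c r →
                     p + q + r + 2 ≡ a + b + c + K
triangle-positions {K} {a = a} long˘ short short = eq K a
  where
  eq : ∀ K a → K + a + a + suc a + 2 ≡ a + suc a + suc (suc a) + K
  eq = solve-∀
triangle-positions {K} {a = a} short˘ long short˘ = eq K a
  where
  eq : ∀ K a → a + (K + a) + suc a + 2 ≡ a + suc (suc a) + suc a + K
  eq = solve-∀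
triangle-positions {K} {b = b} short˘ short˘ long = eq K b
  where
  eq : ∀ K b → suc b + b + (K + b) + 2 ≡ suc b + b + suc (suc b) + K
  eq = solve-∀
triangle-positions {K} {b = b} short long˘ short = eq K b
  where
  eq : ∀ K b → suc b + (K + b) + b + 2 ≡ suc (suc b) + b + suc b + K
  eq = solve-∀
triangle-positions {K} {c = c} short short long˘ = eq K c
  where
  eq : ∀ K c → c + suc c + (K + c) + 2 ≡ suc c + suc (suc c) + c + K
  eq = solve-∀
triangle-positions {K} {c = c} long short˘ short˘ = eq K c
  where
  eq : ∀ K c → K + c + suc c + c + 2 ≡ suc (suc c) + suc c + c + K
  eq = solve-∀

ladder-link : ∀ k (e : LadderE (suc k)) →
              let x , y = ends (TL (suc k)) e in
              Link (shortEdges k) (position x) (position y) (edgePosition k e)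
ladder-link k (uv i) = short
ladder-link k (uu i) rewrite toℕ-inject₁ i = long
ladder-link k (vv i) rewrite toℕ-inject₁ i = long
ladder-link k (vu i) rewrite toℕ-inject₁ i = short

link : ∀ {m} k (e : E (m · TL (suc k))) {x y} → ends (m · TL (suc k)) e ≐ (x , y) →
       Link (shortEdges k) (position (proj₂ x)) (position (proj₂ y)) (edgePosition k (proj₂ e))
link k (_ , e) (inj₁ refl) = ladder-link k e
link k (_ , e) (inj₂ refl) = Link-sym (ladder-link k e)

same-copy : ∀ {m} G (e : E (m · G)) {x y} → ends (m · G) e ≐ (x , y) →
            proj₁ e ≡ proj₁ x × proj₁ x ≡ proj₁ y
same-copy G _ (inj₁ refl) = refl , refl
same-copy G _ (inj₂ refl) = refl , refl

-- Numbering the copies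

copiesIndex : {A : Set} {p : ℕ} (m : ℕ) → A ↔ Fin p → (Fin m × A) ↔ Fin (p * m)
-- The swap makes the copy the low-order digit, as `combine` weights its first argument.
copiesIndex {A} m i = ↔-trans (×-comm (Fin m) A) (↔-trans (i ×-↔ ↔-refl) (↔-sym *↔×))

toℕ-copiesIndex : ∀ {A : Set} {p} m (i : A ↔ Fin p) (c : Fin m) (x : A) →
                  toℕ (to (copiesIndex m i) (c , x)) ≡ m * toℕ (to i x) + toℕ c
toℕ-copiesIndex m i c x = toℕ-combine (to i x) c

opposite-+ : ∀ {n} (i : Fin n) → toℕ (opposite i) + suc (toℕ i) ≡ n
opposite-+ i = trans (cong (_+ suc (toℕ i)) (opposite-prop i)) (m∸n+n≡m (toℕ<n i))

-- The subtraction does not truncate: the minuend equals the left-hand side plus m * K.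
labels-sum : ∀ m K i {a b c p q r l₁ l₂ l₃ t} → p + q + r + 2 ≡ a + b + c + K →
  l₁ + (m * p + i) ≡ t → l₂ + (m * q + i) ≡ t → l₃ + (m * r + i) ≡ t →
  (suc (m * a + i) + (suc (m * b + i) + (suc (m * c + i) + 0))) + (l₁ + (l₂ + (l₃ + 0)))
    ≡ 3 + (t + t + t) + m * 2 ∸ m * K
labels-sum m K i {a} {b} {c} {p} {q} {r} {l₁} {l₂} {l₃} {t} balance eq₁ eq₂ eq₃ = begin
  s                                                    ≡⟨ sym (m+n∸n≡m s (m * K)) ⟩
  s + m * K ∸ m * K                                    ≡⟨ cong (_∸ m * K) (begin
    s + m * K                                            ≡⟨ gather m K i a b c l₁ l₂ l₃ ⟩
    3 + (l₁ + l₂ + l₃) + (i + i + i) + m * (a + b + c + K)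
      ≡⟨ cong (λ z → 3 + (l₁ + l₂ + l₃) + (i + i + i) + m * z) (sym balance) ⟩
    3 + (l₁ + l₂ + l₃) + (i + i + i) + m * (p + q + r + 2) ≡⟨ distribute m i p q r l₁ l₂ l₃ ⟩
    3 + ((l₁ + (m * p + i)) + (l₂ + (m * q + i)) + (l₃ + (m * r + i))) + m * 2
      ≡⟨ cong (λ z → 3 + z + m * 2) (cong₂ _+_ (cong₂ _+_ eq₁ eq₂) eq₃) ⟩
    3 + (t + t + t) + m * 2                              ∎) ⟩
  3 + (t + t + t) + m * 2 ∸ m * K                      ∎
  where
  open ≡-Reasoning
  s = (suc (m * a + i) + (suc (m * b + i) + (suc (m * c + i) + 0))) + (l₁ + (l₂ + (l₃ + 0)))

  gather : ∀ m K i a b c l₁ l₂ l₃ →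
    (suc (m * a + i) + (suc (m * b + i) + (suc (m * c + i) + 0))) + (l₁ + (l₂ + (l₃ + 0))) + m * K
    ≡ 3 + (l₁ + l₂ + l₃) + (i + i + i) + m * (a + b + c + K)
  gather = solve-∀

  distribute : ∀ m i p q r l₁ l₂ l₃ →
    3 + (l₁ + l₂ + l₃) + (i + i + i) + m * (p + q + r + 2)
    ≡ 3 + ((l₁ + (m * p + i)) + (l₂ + (m * q + i)) + (l₃ + (m * r + i))) + m * 2
  distribute = solve-∀

-- The labeling of the copies and its magic constant

module _ (m k : ℕ) where

  private
    G = m · TL (suc k)
    P = order G
    -- The number of edges, in the form that `copiesIndex` produces.
    Q = (1 + 2 * (k * 2)) * m

  vertexNumber : V G ↔ Fin P
  vertexNumber = recount (V-finite G) (copiesIndex m (vertexIndex (suc k)))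

  edgeNumber : E G ↔ Fin (size G)
  edgeNumber = recount (E-finite G) (↔-trans (copiesIndex m (edgeIndex k)) reverse)

  label : V G ⊎ E G → ℕ
  label = verticesFirst {G} vertexNumber edgeNumber

  vertex-label : ∀ i x → label (inj₁ (i , x)) ≡ suc (m * position x + toℕ i)
  vertex-label i x = cong suc (trans
    (toℕ-recount (V-finite G) (copiesIndex m (vertexIndex (suc k))) (i , x))
    (trans (toℕ-copiesIndex m (vertexIndex (suc k)) i x)
           (cong (λ z → m * z + toℕ i) (toℕ-vertexIndex (suc k) x))))

  -- Reversal turns the forward index j into Q - 1 - j, and the 1 lost there is regained because
  -- labels start at 1.
  edge-label : ∀ i e → label (inj₂ (i , e)) + (m * edgePosition k e + toℕ i) ≡ P + Q
  edge-label i e = begin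
    suc (P + toℕ (to edgeNumber (i , e))) + (m * edgePosition k e + toℕ i)
      ≡⟨ cong₂ (λ y z → suc (P + y) + (m * z + toℕ i))
           (toℕ-recount (E-finite G) (↔-trans (copiesIndex m (edgeIndex k)) reverse) (i , e))
           (sym (toℕ-edgeIndex k e)) ⟩
    suc (P + toℕ (opposite j)) + (m * toℕ (to (edgeIndex k) e) + toℕ i)
      ≡⟨ cong (suc (P + toℕ (opposite j)) +_) (sym (toℕ-copiesIndex m (edgeIndex k) i e)) ⟩
    suc (P + toℕ (opposite j)) + toℕ j    ≡⟨ sym (+-suc (P + toℕ (opposite j)) (toℕ j)) ⟩
    P + toℕ (opposite j) + suc (toℕ j)    ≡⟨ +-assoc P _ _ ⟩
    P + (toℕ (opposite j) + suc (toℕ j))  ≡⟨ cong (P +_) (opposite-+ j) ⟩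
    P + Q                                 ∎
    where
    open ≡-Reasoning
    j = to (copiesIndex m (edgeIndex k)) (i , e)

  -- An edge never leaves its copy, so the whole triangle lies in the copy of `x 0F`.
  -- `triangle-positions` then supplies the balance that `labels-sum` converts into the weight.
  triangle-labels : (x : Fin 3 → V G) (e : Fin 3 → E G) →
    (∀ j → ends G (e j) ≐ map x x (cycleEnds j)) →
    ∑ (Fin-finite 3) (label ∘ inj₁ ∘ x) + ∑ (Fin-finite 3) (label ∘ inj₂ ∘ e)
      ≡ 3 + (P + Q + (P + Q) + (P + Q)) + m * 2 ∸ m * shortEdges k
  triangle-labels x e ends-e = trans
    (cong (_+ ∑ (Fin-finite 3) (label ∘ inj₂ ∘ e))
      -- The sum over `Fin 3` unfolds to three terms and a final 0.
      (cong₂ _+_ (vertex 0F refl) (cong₂ _+_ (vertex 1F (sym x₀x₁)) (cong (_+ 0) (vertex 2F x₂x₀)))))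
    (labels-sum m (shortEdges k) (toℕ c)
      (triangle-positions (link k (e 0F) (ends-e 0F)) (link k (e 1F) (ends-e 1F))
                          (link k (e 2F) (ends-e 2F)))
      (edge 0F (trans e₀x₂ x₂x₀)) (edge 1F e₁x₀) (edge 2F (trans e₂x₁ (sym x₀x₁))))
    where
    c = proj₁ (x 0F)

    copy : ∀ j → proj₁ (e j) ≡ proj₁ (x (proj₁ (cycleEnds j))) ×
                 proj₁ (x (proj₁ (cycleEnds j))) ≡ proj₁ (x (proj₂ (cycleEnds j)))
    copy j = same-copy (TL (suc k)) (e j) (ends-e j)

    e₀x₂ = proj₁ (copy 0F)
    x₂x₀ = proj₂ (copy 0F)
    e₁x₀ = proj₁ (copy 1F)
    x₀x₁ = proj₂ (copy 1F)
    e₂x₁ = proj₁ (copy 2F)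

    vertex : ∀ j → proj₁ (x j) ≡ c → label (inj₁ (x j)) ≡ suc (m * position (proj₂ (x j)) + toℕ c)
    vertex j eq = trans (vertex-label (proj₁ (x j)) (proj₂ (x j)))
      (cong (λ i → suc (m * position (proj₂ (x j)) + toℕ i)) eq)

    edge : ∀ j → proj₁ (e j) ≡ c →
           label (inj₂ (e j)) + (m * edgePosition k (proj₂ (e j)) + toℕ c) ≡ P + Q
    edge j eq = subst (λ i → label (inj₂ (e j)) + (m * edgePosition k (proj₂ (e j)) + toℕ i) ≡ P + Q)
      eq (edge-label (proj₁ (e j)) (proj₂ (e j)))

  triangle-weight : (S : Subgraph G) → asGraph S ≅ C₃ →
    weight label S ≡ 3 + (P + Q + (P + Q) + (P + Q)) + m * 2 ∸ m * shortEdges k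
  triangle-weight S φ = trans (weight-≅ label S φ)
    (triangle-labels (proj₁ ∘ from vertices) (proj₁ ∘ from (edges φ))
      -- The inverse of `φ` carries the ends of cycle edge `j` into `S`; `proj₁` then forgets
      -- membership in `S`.
      (λ j → ≐-map proj₁ (ends-edgeTo (≅-sym φ) j)))
    where open _≅_ φ

theorem4 : (m n : ℕ) → 2 ≤ m → 3 ≤ n → Supermagic C₃ (m · TL n)
-- Here n = k + 2, and the labeling is parametrized by n - 1, that is `suc k`.
theorem4 m (suc (suc k)) _ (s≤s (s≤s _)) =
  verticesFirst-supermagic {G} (vertexNumber m (suc k)) (edgeNumber m (suc k)) {C₃}
    (embeddingsCover⇒covering {C₃} {G} (copies-cover {C₃} {TL (2 + k)} {m} (ladder-cover k)))
    (_ , triangle-weight m (suc k))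
  where G = m · TL (2 + k)
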